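{- Protocol MULTI-BB-BROAD-A$(n,\Delta)$ (described in the context) completes any $r$-broadcast operation within $O((D+c)\min\{n,\Delta^2\log n\})$ time-slots on any $n$-node directed graph of maximum eccentricity $D$, maximum in-degree $\Delta$, and congestion $c$.
   Context: A (radio) network is a directed graph whose $n$ nodes have distinct labels in $[n]=\{1,\dots,n\}$; an edge $(u,v)$ means $u$ can transmit to $v$ in one hop. An $r$-broadcast operation ($r\ge1$) is a set of $r$ independent broadcasts: $r$ broadcast messages with distinct IDs initially reside at source nodes (an arbitrary multiset of nodes), and each must be received by all nodes reachable from its source. Communication proceeds in synchronous time-slots; in each slot each node acts either as a transmitter, sending one message (containing at most one broadcast message; bounded-bandwidth model) along all its outgoing edges, or as a receiver. A node receives a message in a slot if and only if it acts as a receiver and exactly one of its in-neighbours acts as a transmitter in that slot. The actions of a node are a function of its label, the slot number and the messages it received in previous slots; here nodes also know $n$ and $\Delta$. The operation is completed within $t$ slots if every broadcast message is received by all nodes reachable from its source within the first $t$ slots. The congestion $c$ is the maximum, over all nodes, of the number of broadcast messages that the node has to receive. The eccentricity of a source node is its largest distance to a node reachable from it; the maximum eccentricity $D$ is the maximum over all possible source nodes. An $(n,k)$-strongly-selective family is a family $\mathcal F$ of subsets of $[n]$ such that for every $Z\subseteq[n]$ with $|Z|\le k$ and every $z\in Z$ there is $F\in\mathcal F$ with $Z\cap F=\{z\}$. Protocol MULTI-BB-BROAD-A$(n,\Delta)$: each broadcast message has a priority, and the priorities induce a total ordering on the set of broadcast messages (for instance the $h$-th message of the source with label $l$ has priority $(l,h)$,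 and $(l,h)$ is higher than $(l',h')$ if $l<l'$, or $l=l'$ and $h<h'$). Every node stores messages in a priority queue. The protocol uses an $(n,\Delta+1)$-strongly-selective family $\mathcal F=\{F_1,\dots,F_{|\mathcal F|}\}$ of size $O(\min\{n,\Delta^2\log n\})$ and consists of consecutive phases of $|\mathcal F|$ time-slots each. At the very beginning the queues of the source nodes contain their broadcast messages and the other queues are empty. At the beginning of each phase, every node $v$ with a non-empty queue extracts from it the message $m_v$ of highest priority. At the $j$-th time-slot of the phase: if the label of $v$ belongs to $F_j$ and $m_v$ exists, then $v$ transmits $m_v$; in all other cases $v$ acts as a receiver, and if it receives a message it has never received before, the message is enqueued, otherwise it is discarded. -}

module Defs where

open import Level using (0ℓ)
open import Data.Bool using (if_then_else_)
open import Data.Fin using (Fin)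
import Data.Fin.Properties as Fin
open import Data.Fin.Subset using (Subset; _∈_; _∩_; ⁅_⁆; ∣_∣)
open import Data.Fin.Subset.Properties using (_∈?_)
open import Data.List using (List; []; _∷_; length; filter; mapMaybe; foldr; allFin)
import Data.List.Membership.DecPropositional as DecMembership
open import Data.Maybe using (Maybe; just; nothing)
open import Data.Nat using (ℕ; zero; suc; _≤_; _<_; _*_; _^_; _⊓_; NonZero; _≟_)
open import Data.Nat.DivMod using (_%_; _mod_)
open import Data.Nat.Logarithm using (⌈log₂_⌉)
open import Data.Product using (_×_; _,_; proj₁; proj₂; ∃; ∃-syntax)
open import Data.Sum using (_⊎_)
open import Data.Vec using (Vec; lookup)
open import Function.Bundles using (_⇔_)
open import Relation.Binary using (Rel; Decidable; IsStrictTotalOrder)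
open import Relation.Binary.PropositionalEquality using (_≡_)
open import Relation.Nullary.Decidable using (does)

IsMinimum IsMaximum : (ℕ → Set) → ℕ → Set
IsMinimum P m = P m × (∀ k → P k → m ≤ k)
IsMaximum P m = P m × (∀ k → P k → k ≤ m)

Counts : ∀ {r} → (Fin r → Set) → ℕ → Set
Counts {r} P k = ∃[ S ] ((∀ i → i ∈ S ⇔ P i) × ∣ S ∣ ≡ k)

-- The n nodes carry distinct labels from an n-element set, so a node is
-- identified with its label, an element of Fin n.  Self-loops are allowed; they
-- count towards the in-degree but have no effect on communication.
record Digraph (n : ℕ) : Set₁ where
  field
    Edge  : Rel (Fin n) 0ℓ
    edge? : Decidable Edge

  inNeighbours : Fin n → List (Fin n)
  inNeighbours v = filter (λ u → edge? u v) (allFin n)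

  data Walk : ℕ → Fin n → Fin n → Set where
    here : ∀ {u} → Walk zero u u
    step : ∀ {k u v w} → Edge u v → Walk k v w → Walk (suc k) u w

  Reachable : Fin n → Fin n → Set
  Reachable u v = ∃[ k ] Walk k u v

  IsDistance : Fin n → Fin n → ℕ → Set
  IsDistance u v = IsMinimum (λ k → Walk k u v)

  IsEccentricity : Fin n → ℕ → Set
  IsEccentricity u = IsMaximum (λ d → ∃[ v ] IsDistance u v d)

  -- Every node is a possible source.
  IsMaxEccentricity : ℕ → Set
  IsMaxEccentricity = IsMaximum (λ e → ∃[ u ] IsEccentricity u e)

  IsMaxInDegree : ℕ → Set
  IsMaxInDegree = IsMaximum (λ d → ∃[ v ] length (inNeighbours v) ≡ d)

-- A distributed protocol: the state of a node evolves as a function of its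
-- label, the slot number, the messages it holds initially and the messages it
-- receives.  In a slot, `act` returns an updated state together with `just m` if
-- the node transmits m, or `nothing` if it acts as a receiver; `receive` is
-- applied only when a message is actually received.
record Protocol (n : ℕ) (Msg : Set) : Set₁ where
  field
    State   : Set
    initial : Fin n → List Msg → State
    act     : Fin n → ℕ → State → State × Maybe Msg
    receive : Fin n → ℕ → State → Msg → State

-- An r-broadcast operation is given by the source of each of its r messages,
-- whose IDs are the elements of Fin r.
module Broadcast {n r} (G : Digraph n) (source : Fin r → Fin n) where
  open Digraph G

  -- A node is reachable from itself, so a source counts its own messages.
  HasToReceive : Fin n → Fin r → Set
  HasToReceive v i = Reachable (source i) v

  IsCongestion : ℕ → Set
  IsCongestion = IsMaximum (λ k → ∃[ v ] Counts (HasToReceive v) k)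

-- Slots are numbered from 0.
module Execution {n r} (G : Digraph n) (source : Fin r → Fin n)
                 (P : Protocol n (Fin r)) where
  open Digraph G
  open Broadcast G source
  open Protocol P

  exactlyOne : List (Fin r) → Maybe (Fin r)
  exactlyOne (m ∷ []) = just m
  exactlyOne _        = nothing

  heard : (Fin n → Maybe (Fin r)) → Fin n → Maybe (Fin r)
  heard transmission v with transmission v
  ... | just _  = nothing
  ... | nothing = exactlyOne (mapMaybe transmission (inNeighbours v))

  state        : ℕ → Fin n → State
  transmission : ℕ → Fin n → Maybe (Fin r)
  reception    : ℕ → Fin n → Maybe (Fin r)

  state zero    v = initial v (filter (λ i → source i Fin.≟ v) (allFin r))
  state (suc t) v with reception t v
  ... | just m  = receive v t (proj₁ (act v t (state t v))) m
  ... | nothing = proj₁ (act v t (state t v))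

  transmission t v = proj₂ (act v t (state t v))

  reception t = heard (transmission t)

  -- A message counts as received by its source from the outset.
  ReceivedWithin : ℕ → Fin n → Fin r → Set
  ReceivedWithin t v i =
    source i ≡ v ⊎ (∃[ t′ ] (t′ < t × reception t′ v ≡ just i))

  CompletesWithin : ℕ → Set
  CompletesWithin t = ∀ i v → HasToReceive v i → ReceivedWithin t v i

StronglySelective : ∀ {n m} → ℕ → Vec (Subset n) m → Set
StronglySelective {n} k F =
  ∀ (Z : Subset n) → ∣ Z ∣ ≤ k → ∀ z → z ∈ Z → ∃[ j ] Z ∩ lookup F j ≡ ⁅ z ⁆

-- i ≺ j means that i has higher priority than j.
module MultiBBBroadA {n m} .{{_ : NonZero m}} (F : Vec (Subset n) m)
                     {Msg : Set} {_≺_ : Rel Msg 0ℓ}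
                     (priority : IsStrictTotalOrder _≡_ _≺_) where
  open IsStrictTotalOrder priority using (_<?_) renaming (_≟_ to _≟ᵐ_)
  open DecMembership _≟ᵐ_ using () renaming (_∈?_ to _∈ˡ?_)

  -- The queue is kept sorted, highest priority first.  `known` lists the messages
  -- received so far, including those held initially; `current` is the message
  -- m_v extracted for the ongoing phase, if any.
  record NodeState : Set where
    constructor mkState
    field
      queue   : List Msg
      known   : List Msg
      current : Maybe Msg

  open NodeState

  enqueue : Msg → List Msg → List Msg
  enqueue x []       = x ∷ []
  enqueue x (y ∷ ys) = if does (x <? y) then x ∷ y ∷ ys else y ∷ enqueue x ys

  startPhase : NodeState → NodeState
  startPhase (mkState []      k _) = mkState [] k nothing
  startPhase (mkState (x ∷ q) k _) = mkState q k (just x)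

  beginSlot : ℕ → NodeState → NodeState
  beginSlot t s = if does (t % m ≟ 0) then startPhase s else s

  protocol : Protocol n Msg
  protocol = record
    { State   = NodeState
    ; initial = λ v ms → mkState (foldr enqueue [] ms) ms nothing
    ; act     = λ v t s →
        beginSlot t s ,
        (if does (v ∈? lookup F (t mod m)) then current (beginSlot t s) else nothing)
    ; receive = λ v t s x →
        if does (x ∈ˡ? known s)
        then s
        else mkState (enqueue x (queue s)) (x ∷ known s) (current s)
    }

-- The function min {n, Δ² log n}.  It vanishes exactly when n ≤ 1 or Δ = 0.
selBound : ℕ → ℕ → ℕ
selBound n Δ = n ⊓ (Δ ^ 2 * ⌈log₂ n ⌉)

{-# OPTIONS --safe #-}

-- The family is selective for each node together with its in-neighbours, so whatever a
-- node extracts for a phase is known to all its out-neighbours when the phase ends.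
-- Fix a message x and a shortest path from its source.  As long as the k-th node of
-- the path has not extracted x, it has extracted at least p − k messages of higher
-- priority in the first p phases: if it has nothing of priority at least x left to
-- extract, then it has extracted everything relevant that its predecessor did, and the
-- predecessor is one phase ahead.  The end v of the path has to receive x and all these
-- messages, so there are fewer than c of them and v extracts x within D + c phases.
--
-- Distances, eccentricities and reachability are not computed: the conclusions drawn from
-- them are decidable, hence stable under double negation, which permits classical
-- reasoning about them.

module Submission where

open import Defs
open import Data.Bool using (true; false; if_then_else_)
open import Data.Fin using (Fin; zero; suc; toℕ)
import Data.Fin.Properties as Fin
open import Data.Fin.Subset using (Subset; inside; outside; _∪_; ⋃; ⁅_⁆; ∣_∣)
  renaming (_∈_ to _∈ˢ_; _∉_ to _∉ˢ_)
open import Data.Fin.Subset.Properties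
  using (_∈?_; ∣⊥∣≡0; ∣⁅x⁆∣≡1; x∈⁅x⁆; x∈⁅y⁆⇒x≡y; x∈p∪q⁺; x∈p∩q⁺; x∈p∩q⁻;
         x∈p∧x≢y⇒x∈p-y; x∈p⇒∣p-x∣<∣p∣)
open import Data.List using (List; []; _∷_; _++_; length; filter; map; mapMaybe; fromMaybe; foldr; allFin)
open import Data.List.Extrema.Nat using (argmax; f[xs]≤f[argmax])
open import Data.List.Membership.Propositional using (_∈_; _∉_)
open import Data.List.Membership.Propositional.Properties
  using (∈-filter⁺; ∈-filter⁻; ∈-allFin; ∈-++⁺ʳ; ∈-++⁻; ∈-length)
import Data.List.Membership.DecPropositional as DecMembership
open import Data.List.Relation.Unary.All as All using (All; []; _∷_)
open import Data.List.Relation.Unary.All.Properties using (¬Any⇒All¬)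
open import Data.List.Relation.Unary.AllPairs using (AllPairs; []; _∷_)
open import Data.List.Relation.Unary.Any using (here; there)
open import Data.List.Relation.Unary.Unique.Propositional using (Unique)
open import Data.List.Relation.Unary.Unique.Propositional.Properties
  using (allFin⁺; filter⁺; Unique[x∷xs]⇒x∉xs)
open import Data.Maybe using (Maybe; just; nothing; maybe′)
open import Data.Nat using (ℕ; zero; suc; _≤_; _<_; _+_; _*_; _∸_; z≤n; s≤s; NonZero; _≟_)
open import Data.Nat.DivMod using (_%_; _mod_; m<n⇒m%n≡m; [m+kn]%n≡m%n; m%n<n)
open import Data.Nat.Induction using (<-rec)
open import Data.Nat.Logarithm using (⌈log₂⌉-mono-≤)
open import Data.Nat.Properties
  using (≤-refl; ≤-trans; ≤-reflexive; ≮⇒≥; <⇒≱; _≤?_; m≤n⇒m≤1+n; <⇒≤; +-comm;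
         +-suc; +-identityʳ; +-monoˡ-≤; +-monoʳ-≤; +-monoʳ-<; +-mono-≤; *-mono-≤; *-monoʳ-≤;
         +-cancelˡ-≤; m^n>0; ⊓-glb; m∸n+n≡m; n<1+n; module ≤-Reasoning)
open import Data.Nat.Solver using (module +-*-Solver)
open import Data.Product using (_×_; _,_; proj₁; proj₂; ∃; ∃-syntax)
open import Data.Sum using (_⊎_; inj₁; inj₂; [_,_]′)
import Data.Sum as Sum
open import Data.Vec using (Vec; []; _∷_; lookup; tabulate)
open import Data.Vec.Properties using (lookup∘tabulate; lookup⇒[]=; []=⇒lookup)
open import Effect.Monad using (RawMonad)
open import Function.Base using (_∘_; case_of_)
open import Function.Bundles using (_⇔_; mk⇔; module Equivalence)
open import Level using (0ℓ)
open import Relation.Binary using (Rel; IsStrictTotalOrder; tri<; tri≈; tri>)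
open import Relation.Binary.PropositionalEquality
  using (_≡_; _≢_; refl; sym; trans; cong; subst)
open import Relation.Nullary using (¬_; Dec; yes; no; contradiction)
open import Relation.Nullary.Decidable
  using (does; dec-true; dec-false; decidable-stable; ¬¬-excluded-middle)
open import Relation.Nullary.Negation using (¬¬-Monad)

-- Finite sets and lists

∣p∪q∣≤∣p∣+∣q∣ : ∀ {n} (p q : Subset n) → ∣ p ∪ q ∣ ≤ ∣ p ∣ + ∣ q ∣
∣p∪q∣≤∣p∣+∣q∣ []            []            = z≤n
∣p∪q∣≤∣p∣+∣q∣ (outside ∷ p) (outside ∷ q) = ∣p∪q∣≤∣p∣+∣q∣ p q
∣p∪q∣≤∣p∣+∣q∣ (outside ∷ p) (inside  ∷ q) =
  ≤-trans (s≤s (∣p∪q∣≤∣p∣+∣q∣ p q)) (≤-reflexive (sym (+-suc ∣ p ∣ ∣ q ∣)))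
∣p∪q∣≤∣p∣+∣q∣ (inside ∷ p)  (outside ∷ q) = s≤s (∣p∪q∣≤∣p∣+∣q∣ p q)
∣p∪q∣≤∣p∣+∣q∣ (inside ∷ p)  (inside  ∷ q) =
  s≤s (≤-trans (∣p∪q∣≤∣p∣+∣q∣ p q) (+-monoʳ-≤ ∣ p ∣ (m≤n⇒m≤1+n ≤-refl)))

elements : ∀ {n} → List (Fin n) → Subset n
elements = ⋃ ∘ map ⁅_⁆

∈-elements⁺ : ∀ {n} {x : Fin n} xs → x ∈ xs → x ∈ˢ elements xs
∈-elements⁺ (x ∷ xs) (here refl)  = x∈p∪q⁺ (inj₁ (x∈⁅x⁆ x))
∈-elements⁺ (x ∷ xs) (there y∈xs) = x∈p∪q⁺ (inj₂ (∈-elements⁺ xs y∈xs))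

∣elements∣≤length : ∀ {n} (xs : List (Fin n)) → ∣ elements xs ∣ ≤ length xs
∣elements∣≤length {n} []       = ≤-reflexive (∣⊥∣≡0 n)
∣elements∣≤length     (x ∷ xs) = begin
  ∣ ⁅ x ⁆ ∪ elements xs ∣       ≤⟨ ∣p∪q∣≤∣p∣+∣q∣ ⁅ x ⁆ (elements xs) ⟩
  ∣ ⁅ x ⁆ ∣ + ∣ elements xs ∣   ≤⟨ +-mono-≤ (≤-reflexive (∣⁅x⁆∣≡1 x)) (∣elements∣≤length xs) ⟩
  suc (length xs)               ∎
  where open ≤-Reasoning

unique⇒length≤∣p∣ : ∀ {n} {xs : List (Fin n)} {p : Subset n} → Unique xs →
                    (∀ {x} → x ∈ xs → x ∈ˢ p) → length xs ≤ ∣ p ∣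
unique⇒length≤∣p∣ {xs = []}     _                  _    = z≤n
unique⇒length≤∣p∣ {xs = x ∷ xs} (x≢xs ∷ xs-unique) xs⊆p =
  ≤-trans (s≤s (unique⇒length≤∣p∣ xs-unique λ y∈xs →
                  x∈p∧x≢y⇒x∈p-y (xs⊆p (there y∈xs)) (All.lookup x≢xs y∈xs ∘ sym)))
          (x∈p⇒∣p-x∣<∣p∣ (xs⊆p (here refl)))

unique⇒length≤ : ∀ {n} {xs ys : List (Fin n)} → Unique xs →
                 (∀ {x} → x ∈ xs → x ∈ ys) → length xs ≤ length ys
unique⇒length≤ {ys = ys} xs-unique xs⊆ys =
  ≤-trans (unique⇒length≤∣p∣ xs-unique (∈-elements⁺ ys ∘ xs⊆ys)) (∣elements∣≤length ys)

∈-mapMaybe⁻ : ∀ {A B : Set} {f : A → Maybe B} {y} xs → y ∈ mapMaybe f xs →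
              ∃[ x ] (x ∈ xs × f x ≡ just y)
∈-mapMaybe⁻ {f = f} (x ∷ xs) y∈ with f x in eq
... | nothing = let z , z∈xs , fz = ∈-mapMaybe⁻ xs y∈ in z , there z∈xs , fz
... | just _  with y∈
...   | here refl   = x , here refl , eq
...   | there y∈xs  = let z , z∈xs , fz = ∈-mapMaybe⁻ xs y∈xs in z , there z∈xs , fz

mapMaybe-all-nothing : ∀ {A B : Set} {f : A → Maybe B} xs →
                       (∀ {x} → x ∈ xs → f x ≡ nothing) → mapMaybe f xs ≡ []
mapMaybe-all-nothing []       _  = refl
mapMaybe-all-nothing (x ∷ xs) eq rewrite eq (here refl) = mapMaybe-all-nothing xs (eq ∘ there)

-- This is the collision-free case of a reception. Uniqueness of the list makes every other position
-- hold an element different from `x`, hence a silent one.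
mapMaybe-singleton : ∀ {A B : Set} {f : A → Maybe B} {x y} {xs} → Unique xs → x ∈ xs →
                     f x ≡ just y → (∀ {z} → z ∈ xs → z ≢ x → f z ≡ nothing) →
                     mapMaybe f xs ≡ y ∷ []
mapMaybe-singleton {xs = x ∷ xs} (x≢xs ∷ _) (here refl) fx others rewrite fx =
  cong (_ ∷_) (mapMaybe-all-nothing xs λ z∈xs →
    others (there z∈xs) (All.lookup x≢xs z∈xs ∘ sym))
mapMaybe-singleton (z≢xs ∷ xs-unique) (there x∈xs) fx others
  rewrite others (here refl) (All.lookup z≢xs x∈xs) =
  mapMaybe-singleton xs-unique x∈xs fx (others ∘ there)

-- Distances and congestion

-- Excluded middle holds under double negation at each index, and finitely many double negations can
-- be pulled out in front of the quantifier.
¬¬-all-decidable : ∀ {n} (P : Fin n → Set) → ¬ ¬ (∀ i → Dec (P i))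
¬¬-all-decidable P = Fin.sequence (RawMonad.rawApplicative ¬¬-Monad) λ _ → ¬¬-excluded-middle

-- If no minimum existed, strong induction would refute `P` at every number, since a first witness
-- would be a minimum.
¬¬-minimum : ∀ (P : ℕ → Set) {k} → P k → ¬ ¬ ∃ (IsMinimum P)
¬¬-minimum P {k} Pk none =
  <-rec (λ j → ¬ P j)
        (λ j noneBelow Pj → none (j , Pj , λ i Pi → ≮⇒≥ λ i<j → noneBelow i<j Pi)) k Pk

module _ {n} (G : Digraph n) where
  open Digraph G

  walk-snoc : ∀ {k u v w} → Walk k u v → Edge v w → Walk (suc k) u w
  walk-snoc here         vw = step vw here
  walk-snoc (step e uv)  vw = step e (walk-snoc uv vw)

  -- Once it is decided which nodes have a distance from `u`, the eccentricity is a maximum over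
  -- finitely many nodes.
  ¬¬-eccentricity : ∀ u → ¬ ¬ ∃ (IsEccentricity u)
  ¬¬-eccentricity u none = ¬¬-all-decidable (∃ ∘ IsDistance u) (none ∘ eccentricity)
    where
    eccentricity : (∀ v → Dec (∃ (IsDistance u v))) → ∃ (IsEccentricity u)
    eccentricity distance? = dist furthest , attained , maximal
      where
      dist : Fin n → ℕ
      dist v with distance? v
      ... | yes (d , _) = d
      -- The default cannot spoil the maximum, because `u` itself lies at distance 0.
      ... | no  _       = 0

      furthest : Fin n
      furthest = argmax dist u (allFin n)

      attained : ∃[ v ] IsDistance u v (dist furthest)
      attained with distance? furthest
      ... | yes (_ , isDistance) = furthest , isDistance
      -- Here the maximum is the default 0, which `u` attains.
      ... | no  _                = u , here , λ _ _ → z≤n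

      ≤dist : ∀ {v k} → IsDistance u v k → k ≤ dist v
      ≤dist {v} isDistance with distance? v
      ... | yes (d , walk , _) = proj₂ isDistance d walk
      ... | no  unreachable    = contradiction (_ , isDistance) unreachable

      maximal : ∀ k → ∃[ v ] IsDistance u v k → k ≤ dist furthest
      maximal k (v , isDistance) =
        ≤-trans (≤dist isDistance) (All.lookup (f[xs]≤f[argmax] u (allFin n)) (∈-allFin v))

  distance≤maxEccentricity : ∀ {D u v d} → IsMaxEccentricity D → IsDistance u v d → d ≤ D
  distance≤maxEccentricity {D} {u} {v} {d} isMax isDistance =
    decidable-stable (d ≤? D) λ d≰D → ¬¬-eccentricity u λ (e , isEcc) →
      d≰D (≤-trans (proj₂ isEcc d (v , isDistance)) (proj₂ isMax e (u , isEcc)))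

  inNeighbours-unique : ∀ v → Unique (inNeighbours v)
  inNeighbours-unique v = filter⁺ (λ u → edge? u v) (allFin⁺ n)

  ∈-inNeighbours⁺ : ∀ {u v} → Edge u v → u ∈ inNeighbours v
  ∈-inNeighbours⁺ {u} {v} uv = ∈-filter⁺ (λ w → edge? w v) (∈-allFin u) uv

  ∈-inNeighbours⁻ : ∀ {u v} → u ∈ inNeighbours v → Edge u v
  ∈-inNeighbours⁻ {u} {v} u∈ = proj₂ (∈-filter⁻ (λ w → edge? w v) {xs = allFin n} u∈)

  module _ {r} (source : Fin r → Fin n) where
    open Broadcast G source

    -- `Counts` asks for the subset of all messages that `v` has to receive, which is available once
    -- reachability is decided. The goal is decidable, so this may be assumed; the distinct entries
    -- of `xs` then lie in that subset.
    length≤congestion : ∀ {c v xs} → IsCongestion c → Unique xs →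
                        (∀ {i} → i ∈ xs → HasToReceive v i) → length xs ≤ c
    length≤congestion {c} {v} {xs} isMax xs-unique required =
      decidable-stable (length xs ≤? c) λ ≰c →
        ¬¬-all-decidable (HasToReceive v) (≰c ∘ bound)
      where
      bound : (∀ i → Dec (HasToReceive v i)) → length xs ≤ c
      bound required? =
        ≤-trans (unique⇒length≤∣p∣ xs-unique (Equivalence.from ∈S ∘ required))
                (proj₂ isMax _ (v , S , (λ _ → ∈S) , refl))
        where
        S : Subset r
        S = tabulate (does ∘ required?)

        ∈S : ∀ {i} → i ∈ˢ S ⇔ HasToReceive v i
        ∈S {i} = mk⇔ to from
          where
          to : i ∈ˢ S → HasToReceive v i
          -- In the `no` case the second scrutinee would prove `false ≡ true`, so only `yes` is
          -- left.
          to i∈S with required? i | trans (sym (lookup∘tabulate (does ∘ required?) i)) ([]=⇒lookup i∈S)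
          ... | yes p | _ = p

          from : HasToReceive v i → i ∈ˢ S
          from p = lookup⇒[]= i S
            (trans (lookup∘tabulate (does ∘ required?) i) (dec-true (required? i) p))

reachable⇒1≤inDegree : ∀ {n} (G : Digraph n) {Δ u v} → Digraph.IsMaxInDegree G Δ →
                       u ≢ v → Digraph.Reachable G u v → 1 ≤ Δ
reachable⇒1≤inDegree G maxInDegree u≢v (_ , Digraph.here)              = contradiction refl u≢v
reachable⇒1≤inDegree G maxInDegree u≢v (_ , Digraph.step {v = w} uw _) =
  ≤-trans (∈-length (∈-inNeighbours⁺ G uw)) (proj₂ maxInDegree _ (w , refl))

-- Both arguments of the minimum are positive, the second because `⌈log₂ n⌉` is at least `⌈log₂ 2⌉`,
-- which is 1. This makes the size bound on the family applicable.
0<selBound : ∀ {n Δ} → 2 ≤ n → 1 ≤ Δ → 0 < selBound n Δ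
0<selBound {n} {suc Δ} 2≤n (s≤s z≤n) =
  ⊓-glb (<⇒≤ 2≤n) (*-mono-≤ (m^n>0 (suc Δ) 2) (⌈log₂⌉-mono-≤ 2≤n))

≢⇒2≤n : ∀ {n} {u v : Fin n} → u ≢ v → 2 ≤ n
≢⇒2≤n {suc zero}    {zero} {zero} u≢v = contradiction refl u≢v
≢⇒2≤n {suc (suc n)}               _   = s≤s (s≤s z≤n)

-- The node automaton

module NodeProperties {n m} .{{_ : NonZero m}} (F : Vec (Subset n) m)
                      {r} {_≺_ : Rel (Fin r) 0ℓ}
                      (priority : IsStrictTotalOrder _≡_ _≺_) where
  open MultiBBBroadA F priority
  open NodeState
  open IsStrictTotalOrder priority
    using (_<?_; compare; irrefl) renaming (_≟_ to _≟ᵐ_; trans to ≺-trans)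
  open DecMembership _≟ᵐ_ using () renaming (_∈?_ to _∈ˡ?_)

  private Msg = Fin r

  ∈-enqueue⁺ : ∀ {x y} ys → y ≡ x ⊎ y ∈ ys → y ∈ enqueue x ys
  ∈-enqueue⁺         []       (inj₁ refl) = here refl
  ∈-enqueue⁺ {x} {y} (z ∷ ys) y∈ with does (x <? z) | y∈
  ... | true  | inj₁ refl         = here refl
  ... | true  | inj₂ y∈ys         = there y∈ys
  ... | false | inj₁ y≡x          = there (∈-enqueue⁺ ys (inj₁ y≡x))
  ... | false | inj₂ (here refl)  = here refl
  ... | false | inj₂ (there y∈ys) = there (∈-enqueue⁺ ys (inj₂ y∈ys))

  ∈-enqueue⁻ : ∀ {x y} ys → y ∈ enqueue x ys → y ≡ x ⊎ y ∈ ys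
  ∈-enqueue⁻         []       (here refl) = inj₁ refl
  ∈-enqueue⁻ {x} {y} (z ∷ ys) y∈ with does (x <? z) | y∈
  ... | true  | here refl = inj₁ refl
  ... | true  | there y∈′ = inj₂ y∈′
  ... | false | here refl = inj₂ (here refl)
  ... | false | there y∈′ = Sum.map₂ there (∈-enqueue⁻ ys y∈′)

  -- The order is strict, so freshness of `x` is what turns the failure of `x ≺ z` into `z ≺ x`.
  enqueue-sorted : ∀ {x ys} → x ∉ ys → AllPairs _≺_ ys → AllPairs _≺_ (enqueue x ys)
  enqueue-sorted {ys = []}         _  _ = [] ∷ []
  enqueue-sorted {x} {ys = z ∷ ys} x∉ (z≺ys ∷ sorted) with x <? z
  ... | yes x≺z = (x≺z ∷ All.map (≺-trans x≺z) z≺ys) ∷ z≺ys ∷ sorted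
  ... | no  x⊀z = All.tabulate z≺ ∷ enqueue-sorted (x∉ ∘ there) sorted
    where
    z≺x : z ≺ x
    z≺x with compare x z
    ... | tri< x≺z _ _   = contradiction x≺z x⊀z
    ... | tri≈ _ refl _  = contradiction (here refl) x∉
    ... | tri> _ _ z≺x   = z≺x

    z≺ : ∀ {y} → y ∈ enqueue x ys → z ≺ y
    z≺ y∈ with ∈-enqueue⁻ ys y∈
    ... | inj₁ refl = z≺x
    ... | inj₂ y∈ys = All.lookup z≺ys y∈ys

  ∈-enqueueAll⁺ : ∀ {x} xs → x ∈ xs → x ∈ foldr enqueue [] xs
  ∈-enqueueAll⁺ (y ∷ xs) (here refl)  = ∈-enqueue⁺ (foldr enqueue [] xs) (inj₁ refl)
  ∈-enqueueAll⁺ (y ∷ xs) (there x∈xs) =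
    ∈-enqueue⁺ (foldr enqueue [] xs) (inj₂ (∈-enqueueAll⁺ xs x∈xs))

  ∈-enqueueAll⁻ : ∀ {x} xs → x ∈ foldr enqueue [] xs → x ∈ xs
  ∈-enqueueAll⁻ (y ∷ xs) x∈ with ∈-enqueue⁻ (foldr enqueue [] xs) x∈
  ... | inj₁ refl = here refl
  ... | inj₂ x∈′  = there (∈-enqueueAll⁻ xs x∈′)

  enqueueAll-sorted : ∀ {xs} → Unique xs → AllPairs _≺_ (foldr enqueue [] xs)
  enqueueAll-sorted {[]}     _                   = []
  enqueueAll-sorted {x ∷ xs} u@(_ ∷ xs-unique) =
    enqueue-sorted (Unique[x∷xs]⇒x∉xs u ∘ ∈-enqueueAll⁻ xs) (enqueueAll-sorted xs-unique)

  -- E is a ghost variable: the messages extracted so far, which a node does not record.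
  record Consistent (E : List Msg) (s : NodeState) : Set where
    field
      sorted             : AllPairs _≺_ (queue s)
      extracted-unique   : Unique E
      extracted∉queue    : ∀ {x} → x ∈ E → x ∉ queue s
      known⇒             : ∀ {x} → x ∈ known s → x ∈ E ⊎ x ∈ queue s
      ⇒known             : ∀ {x} → x ∈ E ⊎ x ∈ queue s → x ∈ known s
      current⇒extracted  : ∀ {x} → current s ≡ just x → x ∈ E

  open Consistent

  consistent-initial : ∀ {xs} → Unique xs →
                       Consistent [] (mkState (foldr enqueue [] xs) xs nothing)
  consistent-initial {xs} xs-unique = record
    { sorted            = enqueueAll-sorted xs-unique
    ; extracted-unique  = []
    ; extracted∉queue   = λ ()
    ; known⇒            = inj₂ ∘ ∈-enqueueAll⁺ xs
    ; ⇒known            = λ { (inj₂ x∈) → ∈-enqueueAll⁻ xs x∈ }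
    ; current⇒extracted = λ ()
    }

  -- `startPhase` leaves the message that it extracts in `current`, so the extension of the ghost
  -- list can be read off there; it is empty for an empty queue.
  withFetched : NodeState → List Msg → List Msg
  withFetched s E = fromMaybe (current (startPhase s)) ++ E

  consistent-startPhase : ∀ {E s} → Consistent E s → Consistent (withFetched s E) (startPhase s)
  consistent-startPhase {E} {mkState [] k _} con = record
    { sorted            = []
    ; extracted-unique  = extracted-unique con
    ; extracted∉queue   = λ _ ()
    ; known⇒            = known⇒ con
    ; ⇒known            = ⇒known con
    ; current⇒extracted = λ ()
    }
  consistent-startPhase {E} {mkState (x ∷ q) k _} con with sorted con
  ... | x≺q ∷ q-sorted = record
    { sorted            = q-sorted
    ; extracted-unique  = ¬Any⇒All¬ E (λ x∈E → extracted∉queue con x∈E (here refl))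
                            ∷ extracted-unique con
    ; extracted∉queue   = λ { (here refl) x∈q → irrefl refl (All.lookup x≺q x∈q)
                            ; (there y∈E) y∈q → extracted∉queue con y∈E (there y∈q) }
    ; known⇒            = λ y∈k → case known⇒ con y∈k of λ
                            { (inj₁ y∈E)         → inj₁ (there y∈E)
                            ; (inj₂ (here refl)) → inj₁ (here refl)
                            ; (inj₂ (there y∈q)) → inj₂ y∈q }
    ; ⇒known            = λ { (inj₁ (here refl)) → ⇒known con (inj₂ (here refl))
                            ; (inj₁ (there y∈E)) → ⇒known con (inj₁ y∈E)
                            ; (inj₂ y∈q)         → ⇒known con (inj₂ (there y∈q)) }
    ; current⇒extracted = λ { refl → here refl }
    }

  accept : NodeState → Msg → NodeState
  accept s x = if does (x ∈ˡ? known s)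
               then s else mkState (enqueue x (queue s)) (x ∷ known s) (current s)

  consistent-accept : ∀ {E s} x → Consistent E s → Consistent E (accept s x)
  consistent-accept {E} {s} x con with x ∈ˡ? known s
  ... | yes _   = con
  ... | no  x∉k = record
    { sorted            = enqueue-sorted (x∉k ∘ ⇒known con ∘ inj₂) (sorted con)
    ; extracted-unique  = extracted-unique con
    ; extracted∉queue   = λ y∈E y∈q → case ∈-enqueue⁻ (queue s) y∈q of λ
                            { (inj₁ refl) → x∉k (⇒known con (inj₁ y∈E))
                            ; (inj₂ y∈q)  → extracted∉queue con y∈E y∈q }
    ; known⇒            = λ { (here refl) → inj₂ (∈-enqueue⁺ (queue s) (inj₁ refl))
                            ; (there y∈k) → Sum.map₂ (∈-enqueue⁺ (queue s) ∘ inj₂) (known⇒ con y∈k) }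
    ; ⇒known            = λ { (inj₁ y∈E) → there (⇒known con (inj₁ y∈E))
                            ; (inj₂ y∈q) → case ∈-enqueue⁻ (queue s) y∈q of λ
                                { (inj₁ refl) → here refl
                                ; (inj₂ y∈q)  → there (⇒known con (inj₂ y∈q)) } }
    ; current⇒extracted = current⇒extracted con
    }

  accept-current : ∀ s x → current (accept s x) ≡ current s
  accept-current s x with does (x ∈ˡ? known s)
  ... | true  = refl
  ... | false = refl

  ∈-accept⁺ : ∀ s x {y} → y ≡ x ⊎ y ∈ known s → y ∈ known (accept s x)
  ∈-accept⁺ s x y∈ with x ∈ˡ? known s | y∈
  ... | yes x∈k | inj₁ refl = x∈k
  ... | yes _   | inj₂ y∈k  = y∈k
  ... | no  _   | inj₁ refl = here refl
  ... | no  _   | inj₂ y∈k  = there y∈k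

  ∈-accept⁻ : ∀ s x {y} → y ∈ known (accept s x) → y ≡ x ⊎ y ∈ known s
  ∈-accept⁻ s x y∈ with does (x ∈ˡ? known s) | y∈
  ... | true  | y∈k       = inj₂ y∈k
  ... | false | here refl = inj₁ refl
  ... | false | there y∈k = inj₂ y∈k

  startPhase-known : ∀ s → known (startPhase s) ≡ known s
  startPhase-known (mkState []      _ _) = refl
  startPhase-known (mkState (_ ∷ _) _ _) = refl

  beginSlot-known : ∀ t s → known (beginSlot t s) ≡ known s
  beginSlot-known t s with does (t % m ≟ 0)
  ... | true  = startPhase-known s
  ... | false = refl

  ahead : Msg → List Msg → ℕ
  ahead x = length ∘ filter (_<? x)

  -- The head of the queue decides. If it precedes `x`, the count grows. Otherwise it is not `x`
  -- either, as `x` stays unextracted, and by sortedness nothing behind it is `x` or precedes `x`.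
  startPhase-progress :
    ∀ {E s x} → Consistent E s → x ∉ withFetched s E →
    ahead x E < ahead x (withFetched s E) ⊎
    (ahead x E ≤ ahead x (withFetched s E) × (∀ {y} → y ∈ queue s → ¬ y ≺ x × y ≢ x))
  startPhase-progress {E} {mkState [] _ _} _ _ = inj₂ (≤-refl , λ ())
  startPhase-progress {E} {mkState (z ∷ q) _ _} {x} con x∉ with z <? x | sorted con
  ... | yes z≺x | _       = inj₁ ≤-refl
  ... | no  z⊀x | z≺q ∷ _ = inj₂ (≤-refl , λ
    { (here refl) → z⊀x , λ { refl → x∉ (here refl) }
    ; (there y∈q) → (λ y≺x → z⊀x (≺-trans (All.lookup z≺q y∈q) y≺x))
                  , λ { refl → z⊀x (All.lookup z≺q y∈q) } })

-- The executions

module ExecutionProperties {n m′} (F : Vec (Subset n) (suc m′)) (G : Digraph n)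
                           {r} (source : Fin r → Fin n) {_≺_ : Rel (Fin r) 0ℓ}
                           (priority : IsStrictTotalOrder _≡_ _≺_) where
  open Digraph G
  open Broadcast G source
  open MultiBBBroadA F priority
  open NodeState
  open NodeProperties F priority
  open Consistent
  open Execution G source protocol
  open IsStrictTotalOrder priority using (_<?_; irrefl) renaming (_≟_ to _≟ᵐ_)
  open DecMembership _≟ᵐ_ using () renaming (_∈?_ to _∈ˡ?_)

  m : ℕ
  m = suc m′

  begun : ℕ → Fin n → NodeState
  begun t v = beginSlot t (state t v)

  -- Slot `t` extracts before anything is sent or received, and its extraction is counted from
  -- `suc t` on. Hence `state t` goes with `extracted t`, but `begun t` with `extracted (suc t)`.
  extracted : ℕ → Fin n → List (Fin r)
  extracted zero    v = []
  extracted (suc t) v =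
    if does (t % m ≟ 0) then withFetched (state t v) (extracted t v) else extracted t v

  state-suc : ∀ t v → state (suc t) v ≡ maybe′ (accept (begun t v)) (begun t v) (reception t v)
  state-suc t v with reception t v
  ... | just _  = refl
  ... | nothing = refl

  -- An elimination principle for one slot. The second premise keeps the equation for `reception`,
  -- from which `known⇒received` builds its witness.
  state-suc-ind : ∀ (P : NodeState → Set) t v → P (begun t v) →
                  (∀ x → reception t v ≡ just x → P (accept (begun t v) x)) →
                  P (state (suc t) v)
  state-suc-ind P t v Pbegun Paccept with reception t v
  ... | just x  = Paccept x refl
  ... | nothing = Pbegun

  consistent-begun : ∀ t v → Consistent (extracted t v) (state t v) →
                     Consistent (extracted (suc t) v) (begun t v)
  consistent-begun t v con with does (t % m ≟ 0)
  ... | true  = consistent-startPhase con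
  ... | false = con

  consistent : ∀ t v → Consistent (extracted t v) (state t v)
  consistent zero    v = consistent-initial (filter⁺ (λ i → source i Fin.≟ v) (allFin⁺ r))
  consistent (suc t) v =
    state-suc-ind (Consistent (extracted (suc t) v)) t v con (λ x _ → consistent-accept x con)
    where con = consistent-begun t v (consistent t v)

  -- Knowledge, reception and reachability

  extracted⇒known : ∀ t v {x} → x ∈ extracted t v → x ∈ known (state t v)
  extracted⇒known t v = ⇒known (consistent t v) ∘ inj₁

  transmission⇒current : ∀ t v {x} → transmission t v ≡ just x → current (begun t v) ≡ just x
  transmission⇒current t v eq with does (v ∈? lookup F (t mod m))
  ... | true = eq

  transmission⇒known : ∀ t v {x} → transmission t v ≡ just x → x ∈ known (state t v)
  transmission⇒known t v {x} eq = subst (x ∈_) (beginSlot-known t (state t v))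
    (⇒known con (inj₁ (current⇒extracted con (transmission⇒current t v eq))))
    where con = consistent-begun t v (consistent t v)

  known-source : ∀ x → x ∈ known (state 0 (source x))
  known-source x = ∈-filter⁺ (λ i → source i Fin.≟ source x) (∈-allFin x) refl

  known-suc : ∀ t v {x} → x ∈ known (state t v) → x ∈ known (state (suc t) v)
  known-suc t v {x} x∈ = state-suc-ind (λ s → x ∈ known s) t v x∈begun
                           (λ y _ → ∈-accept⁺ (begun t v) y (inj₂ x∈begun))
    where x∈begun = subst (x ∈_) (sym (beginSlot-known t (state t v))) x∈

  known-+ : ∀ j t v {x} → x ∈ known (state t v) → x ∈ known (state (j + t) v)
  known-+ zero    t v x∈ = x∈
  known-+ (suc j) t v x∈ = known-suc (j + t) v (known-+ j t v x∈)

  known-mono : ∀ {t t′} v {x} → t ≤ t′ → x ∈ known (state t v) → x ∈ known (state t′ v)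
  known-mono {t} {t′} v {x} t≤t′ x∈ =
    subst (λ i → x ∈ known (state i v)) (m∸n+n≡m t≤t′) (known-+ (t′ ∸ t) t v x∈)

  received⇒known : ∀ t v {x} → reception t v ≡ just x → x ∈ known (state (suc t) v)
  received⇒known t v eq rewrite state-suc t v | eq = ∈-accept⁺ (begun t v) _ (inj₁ refl)

  known⇒received : ∀ t v {x} → x ∈ known (state t v) → ReceivedWithin t v x
  known⇒received zero    v x∈ =
    inj₁ (proj₂ (∈-filter⁻ (λ i → source i Fin.≟ v) {xs = allFin r} x∈))
  known⇒received (suc t) v {x} =
    state-suc-ind (λ s → x ∈ known s → ReceivedWithin (suc t) v x) t v old
      λ y eq x∈ → case ∈-accept⁻ (begun t v) y x∈ of λ
        { (inj₁ refl) → inj₂ (t , n<1+n t , eq)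
        ; (inj₂ x∈)   → old x∈ }
    where
    old : x ∈ known (begun t v) → ReceivedWithin (suc t) v x
    old x∈ = Sum.map₂ (λ (t′ , t′<t , eq) → t′ , m≤n⇒m≤1+n t′<t , eq)
      (known⇒received t v (subst (x ∈_) (beginSlot-known t (state t v)) x∈))

  exactlyOne-∈ : ∀ {xs x} → exactlyOne xs ≡ just x → x ∈ xs
  exactlyOne-∈ {x ∷ []} refl = here refl

  heard⇒transmitted : ∀ f v {x} → heard f v ≡ just x → ∃[ u ] (Edge u v × f u ≡ just x)
  heard⇒transmitted f v eq with f v
  ... | nothing =
    let u , u∈ , fu = ∈-mapMaybe⁻ (inNeighbours v) (exactlyOne-∈ eq)
    in u , ∈-inNeighbours⁻ G u∈ , fu

  -- A received message is traced back to a sender that knew it when the slot began, and the edge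
  -- from the sender extends the walk. The sender's knowledge is carried forward from `t′` to `t` so
  -- that the recursion is structural.
  known⇒reachable : ∀ t v {x} → x ∈ known (state t v) → HasToReceive v x
  known⇒reachable t v {x} x∈ with known⇒received t v x∈
  ... | inj₁ refl = 0 , here
  known⇒reachable (suc t) v {x} x∈ | inj₂ (t′ , s≤s t′≤t , eq) =
    let u , uv , sent = heard⇒transmitted (transmission t′) v eq
        k , walk      = known⇒reachable t u (known-mono u t′≤t (transmission⇒known t′ u sent))
    in suc k , walk-snoc G walk uv

  -- Slots within a phase

  phase-% : ∀ {j} p → j < m → (j + p * m) % m ≡ j
  phase-% {j} p j<m = trans ([m+kn]%n≡m%n j p m) (m<n⇒m%n≡m j<m)

  phase-mod : ∀ p (j : Fin m) → (toℕ j + p * m) mod m ≡ j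
  phase-mod p j = Fin.toℕ-injective
    (trans (Fin.toℕ-fromℕ< (m%n<n (toℕ j + p * m) m)) (phase-% p (Fin.toℕ<n j)))

  phase-begun : ∀ p v → begun (p * m) v ≡ startPhase (state (p * m) v)
  phase-begun p v rewrite dec-true ((p * m) % m ≟ 0) (phase-% p (s≤s z≤n)) = refl

  inPhase-begun : ∀ p {j} v → suc j < m → begun (suc j + p * m) v ≡ state (suc j + p * m) v
  inPhase-begun p {j} v j<m
    -- The remainder is `suc j`, so no phase starts in this slot.
    rewrite dec-false ((suc j + p * m) % m ≟ 0) (λ eq → case trans (sym (phase-% p j<m)) eq of λ ())
    = refl

  inPhase-current : ∀ p j v → j < m → current (begun (j + p * m) v) ≡ current (begun (p * m) v)
  inPhase-current p zero    v _   = refl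
  inPhase-current p (suc j) v j<m = trans (cong current (inPhase-begun p v j<m))
    (state-suc-ind (λ s → current s ≡ current (begun (p * m) v)) (j + p * m) v ih
      (λ x _ → trans (accept-current (begun (j + p * m) v) x) ih))
    where ih = inPhase-current p j v (<⇒≤ j<m)

  inPhase-extracted : ∀ p j v → j < m →
    extracted (suc (j + p * m)) v ≡ withFetched (state (p * m) v) (extracted (p * m) v)
  inPhase-extracted p zero v _
    rewrite dec-true ((p * m) % m ≟ 0) (phase-% p (s≤s z≤n)) = refl
  inPhase-extracted p (suc j) v j<m
    rewrite dec-false ((suc j + p * m) % m ≟ 0) (λ eq → case trans (sym (phase-% p j<m)) eq of λ ())
    = inPhase-extracted p j v (<⇒≤ j<m)

  phase-extracted : ∀ p v →
    extracted (suc p * m) v ≡ withFetched (state (p * m) v) (extracted (p * m) v)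
  -- `m′` is the index of the last slot of a phase, and `suc (m′ + p * m)` computes to `suc p * m`.
  phase-extracted p v = inPhase-extracted p m′ v ≤-refl

  transmission-∈ : ∀ p {j u} → u ∈ˢ lookup F j →
                   transmission (toℕ j + p * m) u ≡ current (begun (p * m) u)
  transmission-∈ p {j} {u} u∈
    rewrite phase-mod p j | dec-true (u ∈? lookup F j) u∈
    = inPhase-current p (toℕ j) u (Fin.toℕ<n j)

  transmission-∉ : ∀ p {j u} → u ∉ˢ lookup F j → transmission (toℕ j + p * m) u ≡ nothing
  transmission-∉ p {j} {u} u∉
    rewrite phase-mod p j | dec-false (u ∈? lookup F j) u∉ = refl

  heard-unique : ∀ f {u v x} → Edge u v → f v ≡ nothing → f u ≡ just x →
                 (∀ {w} → w ∈ inNeighbours v → w ≢ u → f w ≡ nothing) → heard f v ≡ just x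
  heard-unique f {u} {v} uv fv fu others with f v
  ... | nothing = cong exactlyOne
    (mapMaybe-singleton (inNeighbours-unique G v) (∈-inNeighbours⁺ G uv) fu others)

  -- Delivery within a phase and the delay along a path

  module _ {Δ} (selective : StronglySelective (Δ + 1) F) (maxInDegree : IsMaxInDegree Δ) where

    -- Selectivity for `v` and its in-neighbours gives a slot of the phase in which `u` is the only
    -- one of them allowed to transmit. Including `v` in the set forces it to listen in that slot,
    -- and accounts for the summand 1 in `Δ + 1`.
    phase-delivery : ∀ p {u v x} → Edge u v → u ≢ v → current (begun (p * m) u) ≡ just x →
                     x ∈ known (state (suc p * m) v)
    phase-delivery p {u} {v} {x} uv u≢v cur =
      -- What arrives in slot `j` is known from the next slot on, which is no later than the start
      -- of the next phase.
      known-mono v (+-monoˡ-≤ (p * m) (Fin.toℕ<n j))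
        (received⇒known (toℕ j + p * m) v
          (heard-unique (transmission (toℕ j + p * m)) uv
            (silent (⊆Z (here refl)) (u≢v ∘ sym)) (trans (transmission-∈ p u∈F) cur)
            (λ w∈ → silent (⊆Z (there w∈)))))
      where
      Z : Subset n
      Z = elements (v ∷ inNeighbours v)

      ⊆Z : ∀ {w} → w ∈ v ∷ inNeighbours v → w ∈ˢ Z
      ⊆Z = ∈-elements⁺ (v ∷ inNeighbours v)

      ∣Z∣≤Δ+1 : ∣ Z ∣ ≤ Δ + 1
      ∣Z∣≤Δ+1 = begin
        ∣ Z ∣                       ≤⟨ ∣elements∣≤length (v ∷ inNeighbours v) ⟩
        suc (length (inNeighbours v)) ≤⟨ s≤s (proj₂ maxInDegree _ (v , refl)) ⟩
        suc Δ                       ≡⟨ +-comm 1 Δ ⟩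
        Δ + 1                       ∎
        where open ≤-Reasoning

      selected = selective Z ∣Z∣≤Δ+1 u (⊆Z (there (∈-inNeighbours⁺ G uv)))
      j = proj₁ selected

      u∈F : u ∈ˢ lookup F j
      u∈F = proj₂ (x∈p∩q⁻ Z (lookup F j) (subst (u ∈ˢ_) (sym (proj₂ selected)) (x∈⁅x⁆ u)))

      silent : ∀ {w} → w ∈ˢ Z → w ≢ u → transmission (toℕ j + p * m) w ≡ nothing
      silent w∈Z w≢u = transmission-∉ p λ w∈F →
        w≢u (x∈⁅y⁆⇒x≡y u (subst (_ ∈ˢ_) (proj₂ selected) (x∈p∩q⁺ (w∈Z , w∈F))))

    -- By induction on the phases: the latest extraction is delivered during its own phase, and
    -- knowledge persists. A self-loop is treated apart, since a node does not hear itself but knows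
    -- what it extracts.
    extracted⇒neighbour-known : ∀ p {u v x} → Edge u v → x ∈ extracted (p * m) u →
                                x ∈ known (state (p * m) v)
    extracted⇒neighbour-known (suc p) {u} {v} {x} uv x∈ with u Fin.≟ v
    ... | yes refl = extracted⇒known (suc p * m) v x∈
    ... | no  u≢v  with ∈-++⁻ (fromMaybe (current (startPhase (state (p * m) u))))
                            (subst (x ∈_) (phase-extracted p u) x∈)
    ...   | inj₁ x∈cur = phase-delivery p uv u≢v
                           (trans (cong current (phase-begun p u)) (∈-fromMaybe x∈cur))
      where
      ∈-fromMaybe : ∀ {c} → x ∈ fromMaybe c → c ≡ just x
      ∈-fromMaybe {just _} (here refl) = refl
    ...   | inj₂ x∈old = known-+ m (p * m) v (extracted⇒neighbour-known p uv x∈old)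

    -- The invariant for the `k`-th node of a walk, with the lower bound `p − k` on the number of
    -- extractions ahead of `x` stated without subtraction.
    Delayed : ℕ → Fin n → Fin r → Set
    Delayed k v x = ∀ p → x ∉ extracted (p * m) v → p ≤ k + ahead x (extracted (p * m) v)

    -- A phase that extracts a message ahead of `x` raises both sides of the bound by one, so
    -- induction covers it. Only phases whose start finds nothing up to `x` in the queue remain; for
    -- these `idle` supplies the bound outright, without the induction hypothesis.
    delayed-step :
      ∀ {k v x} →
      (∀ p → x ∉ extracted (p * m) v →
        (∀ {y} → y ∈ queue (state (p * m) v) → ¬ y ≺ x × y ≢ x) →
        suc p ≤ k + ahead x (extracted (p * m) v)) →
      Delayed k v x
    delayed-step           idle zero    _  = z≤n
    delayed-step {k} {v} {x} idle (suc p) x∉ rewrite phase-extracted p v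
      with startPhase-progress (consistent (p * m) v) x∉
    ... | inj₁ more           = ≤-trans (s≤s (delayed-step idle p (x∉ ∘ ∈-++⁺ʳ _)))
                                  (+-monoʳ-< k more)
    ... | inj₂ (≤more , done) = ≤-trans (idle p (x∉ ∘ ∈-++⁺ʳ _) done) (+-monoʳ-≤ k ≤more)

    known⇒extracted : ∀ t v {x y} → (∀ {z} → z ∈ queue (state t v) → ¬ z ≺ x × z ≢ x) →
                      y ≺ x ⊎ y ≡ x → y ∈ known (state t v) → y ∈ extracted t v
    known⇒extracted t v done y≼x y∈ with known⇒ (consistent t v) y∈
    ... | inj₁ y∈E = y∈E
    ... | inj₂ y∈q = contradiction y≼x [ proj₁ (done y∈q) , proj₂ (done y∈q) ]′

    -- The source knows `x` from the outset, so until it extracts `x` its queue contains `x` and the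
    -- remaining case of `delayed-step` never arises.
    delayed-source : ∀ x → Delayed 0 (source x) x
    delayed-source x = delayed-step λ p x∉ done → contradiction
      (known⇒extracted (p * m) (source x) done (inj₂ refl) (known-mono {0} {p * m} (source x) z≤n (known-source x))) x∉

    -- If `v` has nothing up to `x` left in its queue, it has already extracted every such message
    -- that `u` has extracted. So `u` has not extracted `x` either, and its bound passes to `v`; the
    -- extra 1 in `suc k` pays for the current phase.
    delayed-edge : ∀ {k u v x} → Edge u v → Delayed k u x → Delayed (suc k) v x
    delayed-edge {k} {u} {v} {x} uv delayed = delayed-step λ p x∉v done →
      let
        transfer : ∀ {y} → y ≺ x ⊎ y ≡ x → y ∈ extracted (p * m) u → y ∈ extracted (p * m) v
        transfer y≼x = known⇒extracted (p * m) v done y≼x ∘ extracted⇒neighbour-known p uv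

        transfer-ahead : ∀ {y} → y ∈ filter (_<? x) (extracted (p * m) u) →
                         y ∈ filter (_<? x) (extracted (p * m) v)
        transfer-ahead y∈ = let y∈E , y≺x = ∈-filter⁻ (_<? x) {xs = extracted (p * m) u} y∈
                            in ∈-filter⁺ (_<? x) (transfer (inj₁ y≺x) y∈E) y≺x
      in s≤s (≤-trans (delayed p (x∉v ∘ transfer (inj₂ refl)))
                      -- Inclusion alone does not compare lengths of lists; it does because no node
                      -- extracts a message twice.
                      (+-monoʳ-≤ k (unique⇒length≤
                        (filter⁺ (_<? x) (extracted-unique (consistent (p * m) u)))
                        transfer-ahead)))

    delayed-walk : ∀ {j k u v x} → Delayed j u x → Walk k u v → Delayed (k + j) v x
    delayed-walk             delayed here          = delayed
    delayed-walk {j} {suc k} {v = v} {x} delayed (step e walk) =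
      subst (λ i → Delayed i v x) (+-suc k j) (delayed-walk (delayed-edge e delayed) walk)

    -- Were `x` still unextracted, the delay bound at distance `d ≤ D` would give at least `c`
    -- extracted messages ahead of it. Together with `x` these are more than `c` distinct messages
    -- that `v` has to receive.
    extracted-after-D+c : ∀ {D c} → IsMaxEccentricity D → IsCongestion c →
                          ∀ {x v} → HasToReceive v x → x ∈ extracted ((D + c) * m) v
    extracted-after-D+c {D} {c} maxEcc congestion {x} {v} reach@(k , walk) =
      decidable-stable (x ∈ˡ? E) λ x∉E →
        ¬¬-minimum (λ k → Walk k (source x) v) walk λ (d , isDistance) →
          <⇒≱ (ahead<c x∉E) (+-cancelˡ-≤ D c (ahead x E) (begin
            D + c              ≤⟨ delayed-walk (delayed-source x) (proj₁ isDistance) (D + c) x∉E ⟩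
            d + 0 + ahead x E  ≡⟨ cong (_+ ahead x E) (+-identityʳ d) ⟩
            d + ahead x E      ≤⟨ +-monoˡ-≤ _ (distance≤maxEccentricity G maxEcc isDistance) ⟩
            D + ahead x E      ∎))
      where
      open ≤-Reasoning
      E = extracted ((D + c) * m) v

      before : List (Fin r)
      before = filter (_<? x) E

      ahead<c : x ∉ E → ahead x E < c
      ahead<c x∉E = length≤congestion G source {xs = x ∷ before} congestion
        (¬Any⇒All¬ before (x∉E ∘ proj₁ ∘ ∈-filter⁻ (_<? x) {xs = E})
          ∷ filter⁺ (_<? x) (extracted-unique (consistent ((D + c) * m) v)))
        λ { (here refl) → reach
          ; (there y∈)  → known⇒reachable ((D + c) * m) v
              (extracted⇒known ((D + c) * m) v (proj₁ (∈-filter⁻ (_<? x) {xs = E} y∈))) }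

    completes : ∀ {D c} → IsMaxEccentricity D → IsCongestion c →
                ∀ {t} → (D + c) * m ≤ t → CompletesWithin t
    completes {D} {c} maxEcc congestion {t} ≤t x v reach = known⇒received t v
      (known-mono v ≤t (extracted⇒known ((D + c) * m) v (extracted-after-D+c maxEcc congestion reach)))

    -- The size bound is available only for positive `selBound n Δ`. A source holds its own message
    -- at once; any other target requires two nodes and an edge, which make `selBound n Δ` positive.
    completes-selBound :
      ∀ C {D c} → (0 < selBound n Δ → m ≤ C * selBound n Δ) → IsMaxEccentricity D →
      IsCongestion c → CompletesWithin (C * ((D + c) * selBound n Δ))
    completes-selBound C {D} {c} size maxEcc congestion x v reach with source x Fin.≟ v
    ... | yes source≡v = inj₁ source≡v
    ... | no  source≢v = completes maxEcc congestion enough x v reach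
      where
      open ≤-Reasoning
      open +-*-Solver

      enough : (D + c) * m ≤ C * ((D + c) * selBound n Δ)
      enough = begin
        (D + c) * m
          ≤⟨ *-monoʳ-≤ (D + c)
               (size (0<selBound (≢⇒2≤n source≢v) (reachable⇒1≤inDegree G maxInDegree source≢v reach))) ⟩
        (D + c) * (C * selBound n Δ)
          ≡⟨ solve 3 (λ d a s → d :* (a :* s) := a :* (d :* s)) refl (D + c) C (selBound n Δ) ⟩
        C * ((D + c) * selBound n Δ) ∎

theorem5p5 : ∀ (C : ℕ) → ∃[ K ]
    (∀ (n Δ m : ℕ) .{{_ : NonZero m}} (F : Vec (Subset n) m) →
    StronglySelective (Δ + 1) F →
    (0 < selBound n Δ → m ≤ C * selBound n Δ) →
    ∀ (G : Digraph n) (D : ℕ) →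
    Digraph.IsMaxInDegree G Δ →
    Digraph.IsMaxEccentricity G D →
    ∀ (r : ℕ) → 1 ≤ r →
    ∀ (source : Fin r → Fin n) (_≺_ : Rel (Fin r) 0ℓ) (priority : IsStrictTotalOrder _≡_ _≺_) →
    ∀ (c : ℕ) → Broadcast.IsCongestion G source c →
    Execution.CompletesWithin G source (MultiBBBroadA.protocol F priority)
    (K * ((D + c) * selBound n Δ)))
-- `(D + c) * m` slots suffice, so the constant from the size of the family carries over unchanged.
theorem5p5 C = C ,
  λ { n Δ (suc _) F selective size G D maxInDegree maxEcc r _ source _≺_ priority c congestion →
      ExecutionProperties.completes-selBound F G source priority
        selective maxInDegree C size maxEcc congestion }
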